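{- Let $W$ be a non-empty set and $R\subseteq W\times W$ a reflexive and symmetric relation. On the power set algebra $\mathcal{P}(W)$ define, for $A,B\subseteq W$, $$A\mathrel{\mathsf{C}_R}B \iff (\exists x\in A)(\exists y\in B)\; x\mathrel{R}y .$$ Then $\langle \mathcal{P}(W),\mathsf{C}_R\rangle$ is a complete Boolean contact algebra satisfying (C4$^c$): for all $A\subseteq W$ and all families $J\subseteq\mathcal{P}(W)$, if $A\mathrel{\mathsf{C}_R}\bigvee J$, then there is $B\in J$ with $A\mathrel{\mathsf{C}_R}B$.
   Context: A Boolean contact algebra is a pair $\langle\mathfrak{B},\mathsf{C}\rangle$ where $\mathfrak{B}=\langle B,\cdot,+,-,\mathbf{0},\mathbf{1}\rangle$ is a Boolean algebra and $\mathsf{C}\subseteq B\times B$ satisfies, for all $x,y,z\in B$: (C0) not $\mathbf{0}\mathrel{\mathsf{C}}x$; (C1) if $x\le y$ and $x\ne\mathbf{0}$, then $x\mathrel{\mathsf{C}}y$; (C2) if $x\mathrel{\mathsf{C}}y$, then $y\mathrel{\mathsf{C}}x$; (C3) if $x\le y$ and $z\mathrel{\mathsf{C}}x$, then $z\mathrel{\mathsf{C}}y$; (C4) if $x\mathrel{\mathsf{C}}(y+z)$, then $x\mathrel{\mathsf{C}}y$ or $x\mathrel{\mathsf{C}}z$. It is complete if $\mathfrak{B}$ is a complete Boolean algebra. $\bigvee J$ denotes the supremum of $J$ (in $\mathcal{P}(W)$, the union). The algebras $\langle \mathcal{P}(W),\mathsf{C}_R\rangle$ are called relational contact algebras. -}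

module Defs where

open import Algebra.Core using (Op₁; Op₂)
open import Algebra.Lattice.Structures using (IsBooleanAlgebra)
open import Data.Product using (∃; _×_)
open import Data.Sum using (_⊎_)
open import Level using (Level; _⊔_; suc)
open import Relation.Binary.Core using (Rel)
import Relation.Binary.Construct.NaturalOrder.Left as NaturalOrder
open import Relation.Nullary using (¬_)
open import Relation.Unary using (Pred; _∈_)

-- In the definitions below J is an arbitrary predicate on the carrier, not
-- required to respect the equality of the algebra.

record IsSupremum {a ℓ j : Level} {A : Set a} (_≤_ : Rel A ℓ)
                  (J : Pred A j) (s : A) : Set (a ⊔ ℓ ⊔ j) where
  field
    upper : ∀ x → x ∈ J → x ≤ s
    least : ∀ u → (∀ x → x ∈ J → x ≤ u) → s ≤ u

record IsInfimum {a ℓ j : Level} {A : Set a} (_≤_ : Rel A ℓ)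
                 (J : Pred A j) (i : A) : Set (a ⊔ ℓ ⊔ j) where
  field
    lower    : ∀ x → x ∈ J → i ≤ x
    greatest : ∀ l → (∀ x → x ∈ J → l ≤ x) → l ≤ i

record IsBooleanContactAlgebra
  {a ℓ c : Level} {A : Set a} (_≈_ : Rel A ℓ)
  (_+_ _·_ : Op₂ A) (-_ : Op₁ A) (𝟏 𝟎 : A) (_C_ : Rel A c) :
  Set (a ⊔ ℓ ⊔ c) where

  -- x ≤ y is x ≈ x · y
  open NaturalOrder _≈_ _·_ public using (_≤_)

  field
    isBooleanAlgebra : IsBooleanAlgebra _≈_ _+_ _·_ -_ 𝟏 𝟎
    C0 : ∀ x → ¬ (𝟎 C x)
    C1 : ∀ x y → x ≤ y → ¬ (x ≈ 𝟎) → x C y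
    C2 : ∀ x y → x C y → y C x
    C3 : ∀ x y z → x ≤ y → z C x → z C y
    C4 : ∀ x y z → x C (y + z) → (x C y) ⊎ (x C z)

-- j is the universe level of the subsets J.
record IsCompleteBooleanContactAlgebra
  {a ℓ c : Level} (j : Level) {A : Set a} (_≈_ : Rel A ℓ)
  (_+_ _·_ : Op₂ A) (-_ : Op₁ A) (𝟏 𝟎 : A) (_C_ : Rel A c) :
  Set (a ⊔ ℓ ⊔ c ⊔ suc j) where

  field
    isBooleanContactAlgebra :
      IsBooleanContactAlgebra _≈_ _+_ _·_ -_ 𝟏 𝟎 _C_

  open IsBooleanContactAlgebra isBooleanContactAlgebra public

  field
    suprema : ∀ (J : Pred A j) → ∃ λ s → IsSupremum _≤_ J s
    infima  : ∀ (J : Pred A j) → ∃ λ i → IsInfimum _≤_ J i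

-- (C4ᶜ); the hypothesis x C ⋁ J is expressed for any s that is a supremum of J.
C4ᶜ : {a ℓ c : Level} (j : Level) {A : Set a} (_≈_ : Rel A ℓ)
      (_·_ : Op₂ A) (_C_ : Rel A c) → Set (a ⊔ ℓ ⊔ c ⊔ suc j)
C4ᶜ j {A} _≈_ _·_ _C_ =
  ∀ (x : A) (J : Pred A j) (s : A) → IsSupremum _≤_ J s →
  x C s → ∃ λ y → y ∈ J × x C y
  where open NaturalOrder _≈_ _·_ using (_≤_)

relationalContact : {w r ℓ : Level} {W : Set w} →
                    Rel W r → Rel (Pred W ℓ) (w ⊔ r ⊔ ℓ)
relationalContact R A B = ∃ λ x → x ∈ A × (∃ λ y → y ∈ B × R x y)

{-# OPTIONS --safe #-}
module Submission where

open import Defs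
open import Algebra.Lattice.Structures using (IsBooleanAlgebra)
open import Algebra.Lattice.Structures.Biased using (isBooleanAlgebraʳ)
open import Axiom.ExcludedMiddle using (ExcludedMiddle)
open import Data.Empty using (⊥-elim)
open import Data.Product using (_×_; _,_; proj₁; proj₂; ∃; <_,_>)
open import Data.Sum using (inj₁; inj₂)
open import Function.Base using (id; _∘_)
open import Level using (Level; Lift; lift; lower; _⊔_; suc)
open import Relation.Binary.Core using (Rel)
open import Relation.Binary.Definitions using (Reflexive; Symmetric)
import Relation.Binary.Construct.NaturalOrder.Left as NaturalOrder
open import Relation.Nullary using (¬_)
open import Relation.Nullary.Decidable using (True; toWitness; fromWitness; toSum; map′; decidable-stable)
open import Relation.Unary using (Pred; _∈_; _⊆_; _≐_; _∪_; _∩_; ∁; Satisfiable)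
open import Relation.Unary.Algebra using (∪-∩-isDistributiveLattice)
open import Relation.Unary.Polymorphic using (U; ∅)

-- Contact of A and B is witnessed by a pair of related points, one in each set. It is therefore
-- monotone, and it passes from a union to a member: the witness in the union already lies in some
-- member, which gives both (C4) and (C4ᶜ). Reflexivity gives (C1), symmetry (C2); unions and
-- intersections supply suprema and infima.

private
  variable
    a b w r ℓ j : Level
    W : Set w

-- Excluded middle is assumed once, at the level of quantification over a family of subsets; the
-- Boolean and contact axioms use it at smaller levels.
lowerExcludedMiddle : ExcludedMiddle (a ⊔ b) → ExcludedMiddle a
lowerExcludedMiddle {b = b} em {P} = map′ lower lift (em {Lift b P})

-- (C1) assumes only a negation but needs an actual point; double negation elimination provides it.
nonEmpty : ExcludedMiddle (w ⊔ ℓ) → {W : Set w} {A : Pred W ℓ} →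
  ¬ (A ≐ ∅ {ℓ = ℓ}) → Satisfiable A
nonEmpty em A≢∅ = decidable-stable em λ ¬∃A →
  A≢∅ ((λ x∈A → ⊥-elim (¬∃A (_ , x∈A))) , λ ())

infix 4 _≤_

_≤_ : Rel (Pred W ℓ) _
_≤_ = NaturalOrder._≤_ _≐_ _∩_

-- The order of the algebra is the equation `A ≐ A ∩ B`; the two conversions allow arguing by
-- inclusion.
≤⇒⊆ : {A B : Pred W ℓ} → A ≤ B → A ⊆ B
≤⇒⊆ (A⊆A∩B , _) = proj₂ ∘ A⊆A∩B

⊆⇒≤ : {A B : Pred W ℓ} → A ⊆ B → A ≤ B
⊆⇒≤ A⊆B = < id , A⊆B > , proj₁

isBooleanAlgebra : ExcludedMiddle ℓ → {W : Set w} →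
  IsBooleanAlgebra {A = Pred W ℓ} _≐_ _∪_ _∩_ ∁ U ∅
isBooleanAlgebra {ℓ = ℓ} em {W} = isBooleanAlgebraʳ record
  { isDistributiveLattice = ∪-∩-isDistributiveLattice W ℓ
  ; ∨-complementʳ = λ _ → _ , λ _ → toSum em
  ; ∧-complementʳ = λ _ → (λ (x∈A , x∉A) → ⊥-elim (x∉A x∈A)) , λ ()
  ; ¬-cong        = λ (A⊆B , B⊆A) → (λ x∉A → x∉A ∘ B⊆A) , (λ x∉B → x∉B ∘ A⊆B)
  }

isBooleanContactAlgebra : ExcludedMiddle (w ⊔ ℓ) → {W : Set w} →
  {R : Rel W r} → Reflexive R → Symmetric R →
  IsBooleanContactAlgebra {A = Pred W ℓ}
    _≐_ _∪_ _∩_ ∁ U ∅ (relationalContact R)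
isBooleanContactAlgebra {w = w} em R-refl R-sym = record
  { isBooleanAlgebra = isBooleanAlgebra (lowerExcludedMiddle {b = w} em)
  ; C0 = λ _ ()
  -- One point of A serves on both sides, being related to itself.
  ; C1 = λ _ _ A≤B A≢∅ → let x , x∈A = nonEmpty em A≢∅ in
           x , x∈A , x , ≤⇒⊆ A≤B x∈A , R-refl
  ; C2 = λ _ _ (x , x∈A , y , y∈B , xRy) → y , y∈B , x , x∈A , R-sym xRy
  ; C3 = λ _ _ _ A≤B (z , z∈D , x , x∈A , zRx) → z , z∈D , x , ≤⇒⊆ A≤B x∈A , zRx
  ; C4 = λ where
      _ _ _ (x , x∈A , y , inj₁ y∈B , xRy) → inj₁ (x , x∈A , y , y∈B , xRy)
      _ _ _ (x , x∈A , y , inj₂ y∈D , xRy) → inj₂ (x , x∈A , y , y∈D , xRy)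
  }

-- The union and intersection of a family of subsets live in a larger universe
-- than its members; excluded middle brings them back down to Pred W ℓ by
-- replacing membership with its truth value.
module _ {w ℓ j : Level} (em : ExcludedMiddle (w ⊔ suc ℓ ⊔ j)) {W : Set w} where

  ⋃ : Pred (Pred W ℓ) j → Pred W ℓ
  ⋃ J x = Lift ℓ (True (em {∃ λ A → A ∈ J × x ∈ A}))

  ⋂ : Pred (Pred W ℓ) j → Pred W ℓ
  ⋂ J x = Lift ℓ (True (em {∀ A → A ∈ J → x ∈ A}))

  ⋃-isSupremum : ∀ J → IsSupremum _≤_ J (⋃ J)
  ⋃-isSupremum J = record
    { upper = λ A A∈J → ⊆⇒≤ λ x∈A → lift (fromWitness (A , A∈J , x∈A))
    ; least = λ B J≤B → ⊆⇒≤ λ (lift x∈⋃J) →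
        let A , A∈J , x∈A = toWitness x∈⋃J in ≤⇒⊆ (J≤B A A∈J) x∈A
    }

  ⋂-isInfimum : ∀ J → IsInfimum _≤_ J (⋂ J)
  ⋂-isInfimum J = record
    { lower    = λ A A∈J → ⊆⇒≤ λ (lift x∈⋂J) → toWitness x∈⋂J A A∈J
    ; greatest = λ B B≤J → ⊆⇒≤ λ x∈B →
        lift (fromWitness λ A A∈J → ≤⇒⊆ (B≤J A A∈J) x∈B)
    }

  relationalContact-C4ᶜ : {R : Rel W r} →
    C4ᶜ j {A = Pred W ℓ} _≐_ _∩_ (relationalContact R)
  relationalContact-C4ᶜ A J S S-sup (x , x∈A , y , y∈S , xRy) =
    -- `S` is an arbitrary supremum, so its points are first moved into the concrete union, where
    -- membership yields a member of `J`.
    let S≤⋃J          = IsSupremum.least S-sup (⋃ J) (IsSupremum.upper (⋃-isSupremum J))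
        B , B∈J , y∈B = toWitness (lower (≤⇒⊆ S≤⋃J y∈S))
    in B , B∈J , x , x∈A , y , y∈B , xRy

proposition4p2 : {w r ℓ j : Level} →
    -- classical background logic
    ExcludedMiddle (w ⊔ suc ℓ ⊔ j) →
    (W : Set w) → W →
    (R : Rel W r) → Reflexive R → Symmetric R →
    IsCompleteBooleanContactAlgebra j {A = Pred W ℓ}
      _≐_ _∪_ _∩_ ∁ U ∅ (relationalContact R)
    × C4ᶜ j {A = Pred W ℓ} _≐_ _∩_ (relationalContact R)
proposition4p2 {ℓ = ℓ} {j = j} em W _ R R-refl R-sym =
  record
    { isBooleanContactAlgebra =
        isBooleanContactAlgebra (lowerExcludedMiddle {b = suc ℓ ⊔ j} em) R-refl R-sym
    ; suprema = λ J → ⋃ em J , ⋃-isSupremum em J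
    ; infima  = λ J → ⋂ em J , ⋂-isInfimum em J
    }
  , relationalContact-C4ᶜ em
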